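{- Let $T$ be the Tutte graph. There exists a set $N$ of twelve vertices of $T$ such that, designating the vertices of $N$ as negative and all other vertices as positive, $T$ has no 2-factor $F$ in which every cycle of $F$ contains an even number of positive vertices.
   Context: The Tutte graph is the classical 3-connected cubic planar non-Hamiltonian graph on 46 vertices, obtained from $K_4$ by replacing three of its four vertices by copies of Tutte's fragment. A 2-factor of a graph is a spanning subgraph in which every vertex has degree 2. -}

module Defs where

open import Data.Nat using (ℕ; _≡ᵇ_)
open import Data.Bool using (Bool; true; false; _∨_; if_then_else_)
open import Data.Fin using (Fin; #_; _≟_)
open import Data.Fin.Subset using (Subset; _∈_; _∩_; ∁; ∣_∣; inside; outside)
open import Data.Vec using (Vec; []; _∷_; lookup; tabulate)
open import Data.Product using (_×_; _,_; proj₁; proj₂; Σ)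
open import Data.Sum using (_⊎_)
open import Relation.Binary.PropositionalEquality using (_≡_)
open import Relation.Nullary.Decidable using (⌊_⌋)

-- The Tutte graph: vertices Fin 46, 69 edges given as an explicit list
-- (the standard labelling used e.g. by networkx's tutte_graph).
-- Each undirected edge appears exactly once.
TutteEdges : Vec (Fin 46 × Fin 46) 69
TutteEdges =
  ( # 0 , # 1 ) ∷
  ( # 0 , # 2 ) ∷
  ( # 0 , # 3 ) ∷
  ( # 1 , # 4 ) ∷
  ( # 1 , # 26 ) ∷
  ( # 2 , # 10 ) ∷
  ( # 2 , # 11 ) ∷
  ( # 3 , # 18 ) ∷
  ( # 3 , # 19 ) ∷
  ( # 4 , # 5 ) ∷
  ( # 4 , # 33 ) ∷
  ( # 5 , # 6 ) ∷
  ( # 5 , # 29 ) ∷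
  ( # 6 , # 7 ) ∷
  ( # 6 , # 27 ) ∷
  ( # 7 , # 8 ) ∷
  ( # 7 , # 14 ) ∷
  ( # 8 , # 9 ) ∷
  ( # 8 , # 38 ) ∷
  ( # 9 , # 10 ) ∷
  ( # 9 , # 37 ) ∷
  ( # 10 , # 39 ) ∷
  ( # 11 , # 12 ) ∷
  ( # 11 , # 39 ) ∷
  ( # 12 , # 13 ) ∷
  ( # 12 , # 35 ) ∷
  ( # 13 , # 14 ) ∷
  ( # 13 , # 15 ) ∷
  ( # 14 , # 34 ) ∷
  ( # 15 , # 16 ) ∷
  ( # 15 , # 22 ) ∷
  ( # 16 , # 17 ) ∷
  ( # 16 , # 44 ) ∷
  ( # 17 , # 18 ) ∷
  ( # 17 , # 43 ) ∷
  ( # 18 , # 45 ) ∷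
  ( # 19 , # 20 ) ∷
  ( # 19 , # 45 ) ∷
  ( # 20 , # 21 ) ∷
  ( # 20 , # 41 ) ∷
  ( # 21 , # 22 ) ∷
  ( # 21 , # 23 ) ∷
  ( # 22 , # 40 ) ∷
  ( # 23 , # 24 ) ∷
  ( # 23 , # 27 ) ∷
  ( # 24 , # 25 ) ∷
  ( # 24 , # 32 ) ∷
  ( # 25 , # 26 ) ∷
  ( # 25 , # 31 ) ∷
  ( # 26 , # 33 ) ∷
  ( # 27 , # 28 ) ∷
  ( # 28 , # 29 ) ∷
  ( # 28 , # 32 ) ∷
  ( # 29 , # 30 ) ∷
  ( # 30 , # 31 ) ∷
  ( # 30 , # 33 ) ∷
  ( # 31 , # 32 ) ∷
  ( # 34 , # 35 ) ∷
  ( # 34 , # 38 ) ∷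
  ( # 35 , # 36 ) ∷
  ( # 36 , # 37 ) ∷
  ( # 36 , # 39 ) ∷
  ( # 37 , # 38 ) ∷
  ( # 40 , # 41 ) ∷
  ( # 40 , # 44 ) ∷
  ( # 41 , # 42 ) ∷
  ( # 42 , # 43 ) ∷
  ( # 42 , # 45 ) ∷
  ( # 43 , # 44 ) ∷
  []

incident : Fin 46 → Subset 69
incident v = tabulate λ i →
  ⌊ proj₁ (lookup TutteEdges i) ≟ v ⌋ ∨ ⌊ proj₂ (lookup TutteEdges i) ≟ v ⌋

-- A spanning subgraph of T is given by its edge set F ⊆ E(T).
-- F is a 2-factor iff every vertex has degree exactly 2 in F.
IsTwoFactor : Subset 69 → Set
IsTwoFactor F = (v : Fin 46) → ∣ F ∩ incident v ∣ ≡ 2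

AdjIn : Subset 69 → Fin 46 → Fin 46 → Set
AdjIn F u w = Σ (Fin 69) λ i → i ∈ F ×
  ((lookup TutteEdges i ≡ (u , w)) ⊎ (lookup TutteEdges i ≡ (w , u)))

data Reach (F : Subset 69) : Fin 46 → Fin 46 → Set where
  here : ∀ {u} → Reach F u u
  step : ∀ {u v w} → AdjIn F u v → Reach F v w → Reach F u w

-- C is the vertex set of the component (= cycle, when F is a 2-factor)
-- of F containing v.
IsComponentOf : Subset 69 → Fin 46 → Subset 46 → Set
IsComponentOf F v C = (w : Fin 46) → (w ∈ C → Reach F v w) × (Reach F v w → w ∈ C)

{-# OPTIONS --safe #-}

-- In a 2-factor exactly two edges are chosen at every vertex.  Going through the vertices in
-- an order that keeps the visited part connected, we branch over all choices of these two edges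
-- that agree with the earlier ones, and drop a branch once the cycle through the current vertex
-- is complete and has an odd number of positive vertices.  For the set Negative every branch is
-- dropped; this set and the order were chosen by computer to keep the tree small (about 1500 nodes).
module Submission where

open import Defs
open import Data.Bool as Bool using (Bool; true; false; _∧_; _∨_; if_then_else_)
open import Data.Bool.Properties using (∧-conicalˡ; ∧-conicalʳ)
open import Data.Empty using (⊥-elim)
open import Data.Fin using (Fin; zero; suc; #_; _≟_)
open import Data.Fin.Properties using (all?)
open import Data.Fin.Subset using (Subset; _∩_; ∁; ∣_∣; inside; outside; _∈_)
  renaming (⊥ to ∅)
open import Data.Fin.Subset.Properties using (_∈?_; ∉⊥)
open import Data.List as List using (List; []; _∷_)
open import Data.List.Properties using () renaming (≡-dec to List-≡-dec)
open import Data.List.Relation.Unary.All as All using (All; []; _∷_)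
open import Data.Maybe using (Maybe; just; nothing)
open import Data.Maybe.Properties using (just-injective) renaming (≡-dec to Maybe-≡-dec)
open import Data.Nat using (ℕ; zero; suc; _+_)
open import Data.Nat.Divisibility using (_∣_; _∣?_)
open import Data.Nat.Properties using (suc-injective)
open import Data.Product using (Σ; ∃; _×_; _,_; proj₁; proj₂)
open import Data.Product.Properties using () renaming (≡-dec to ×-≡-dec)
open import Data.Sum using (_⊎_; inj₁; inj₂; [_,_]′)
open import Data.Vec using (Vec; []; _∷_; lookup; tabulate; replicate; _[_]≔_)
open import Data.Vec.Properties
  using (lookup⇒[]=; []=⇒lookup; lookup∘update; lookup∘update′; lookup-replicate)
open import Function using (_∘_)
open import Relation.Binary.PropositionalEquality
  using (_≡_; refl; sym; trans; cong; subst)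
open import Relation.Nullary using (¬_; Dec; yes; no; ¬?; _×-dec_; _⊎-dec_)
open import Relation.Nullary.Decidable using (⌊_⌋; toWitness)

private variable
  n : ℕ

elements : Subset n → List (Fin n)
elements []            = []
elements (inside  ∷ S) = zero ∷ List.map suc (elements S)
elements (outside ∷ S) = List.map suc (elements S)

toℕ : Bool → ℕ
toℕ b = if b then 1 else 0

-- Puts the degree condition into a form that `branch` can use up one edge at a time.
countIn : Subset n → List (Fin n) → ℕ
countIn F []       = 0
countIn F (i ∷ is) = toℕ (lookup F i) + countIn F is

countIn-suc : ∀ b (F : Subset n) is → countIn (b ∷ F) (List.map suc is) ≡ countIn F is
countIn-suc b F []       = refl
countIn-suc b F (i ∷ is) = cong (toℕ (lookup F i) +_) (countIn-suc b F is)

∣∩∣≡countIn : ∀ (F S : Subset n) → ∣ F ∩ S ∣ ≡ countIn F (elements S)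
∣∩∣≡countIn []          []            = refl
∣∩∣≡countIn (true  ∷ F) (inside  ∷ S) =
  cong suc (trans (∣∩∣≡countIn F S) (sym (countIn-suc true F (elements S))))
∣∩∣≡countIn (false ∷ F) (inside  ∷ S) =
  trans (∣∩∣≡countIn F S) (sym (countIn-suc false F (elements S)))
∣∩∣≡countIn (true  ∷ F) (outside ∷ S) =
  trans (∣∩∣≡countIn F S) (sym (countIn-suc true F (elements S)))
∣∩∣≡countIn (false ∷ F) (outside ∷ S) =
  trans (∣∩∣≡countIn F S) (sym (countIn-suc false F (elements S)))

Arc : Set
Arc = Fin 69 × Fin 46

Ends : Fin 69 → Fin 46 → Fin 46 → Set
Ends i u w = lookup TutteEdges i ≡ (u , w) ⊎ lookup TutteEdges i ≡ (w , u)

otherEnd : Fin 46 → Fin 46 × Fin 46 → Fin 46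
otherEnd u (a , b) = if ⌊ a ≟ u ⌋ then b else a

arcsAt : Fin 46 → List Arc
arcsAt u = List.map (λ i → i , otherEnd u (lookup TutteEdges i)) (elements (incident u))

-- The search receives this table as an argument, so that its entries are evaluated only once.
ArcTable : Set
ArcTable = Vec (List Arc) 46

-- The soundness proof sees the table only through these two properties. They are verified by
-- computation for `tutteArcs`, in place of any reasoning about `otherEnd`.
HasEdges HasEnds : ArcTable → Set
HasEdges arcs = ∀ u → List.map proj₁ (lookup arcs u) ≡ elements (incident u)
HasEnds  arcs = ∀ u → All (λ (i , w) → Ends i u w) (lookup arcs u)

tutteArcs : ArcTable
tutteArcs = tabulate arcsAt

tutteArcs-edges : HasEdges tutteArcs
tutteArcs-edges =
  toWitness {a? = all? λ u →
    List-≡-dec _≟_ (List.map proj₁ (lookup tutteArcs u)) (elements (incident u))} _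

tutteArcs-ends : HasEnds tutteArcs
tutteArcs-ends = toWitness {a? = all? λ u → All.all? (λ (i , w) →
    (lookup TutteEdges i ≟² (u , w)) ⊎-dec (lookup TutteEdges i ≟² (w , u))) (lookup tutteArcs u)} _
  where _≟²_ = ×-≡-dec _≟_ _≟_

PartialSubset : ℕ → Set
PartialSubset = Vec (Maybe Bool)

infix 4 _⊑_

record _⊑_ (σ : PartialSubset n) (F : Subset n) : Set where
  field agrees : ∀ i {b} → lookup σ i ≡ just b → lookup F i ≡ b

open _⊑_

undecided-⊑ : (F : Subset n) → replicate n nothing ⊑ F
undecided-⊑ F .agrees i eq with () ← trans (sym (lookup-replicate i nothing)) eq

update-⊑ : ∀ {σ : PartialSubset n} {F b} i → σ ⊑ F → lookup F i ≡ b → σ [ i ]≔ just b ⊑ F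
update-⊑ {σ = σ} i σ⊑F Fi .agrees j eq with j ≟ i
... | yes refl = trans Fi (just-injective (trans (sym (lookup∘update i σ _)) eq))
... | no  j≢i  = agrees σ⊑F j (trans (sym (lookup∘update′ j≢i σ _)) eq)

module _ (arcs : ArcTable) (σ : PartialSubset 69) where

  mutual
    explore : ℕ → Fin 46 → Subset 46 → Subset 46
    explore zero    u C = C
    explore (suc k) u C =
      if lookup C u then C else exploreAll k (lookup arcs u) (C [ u ]≔ inside)

    exploreAll : ℕ → List Arc → Subset 46 → Subset 46
    exploreAll k []             C = C
    exploreAll k ((i , w) ∷ as) C with lookup σ i
    ... | just true = exploreAll k as (explore k w C)
    ... | _         = exploreAll k as C

  -- 46 + 1: the search for the component never runs out of fuel.
  component : Fin 46 → Subset 46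
  component u = explore 47 u ∅

-- An undecided edge may not leave `C` either, so `C` is closed under adjacency in every `F` with
-- `σ ⊑ F`, however the remaining edges are chosen.
Saturated : PartialSubset 69 → Subset 46 → Set
Saturated σ C = ∀ i → lookup σ i ≡ just false ⊎
  lookup C (proj₁ (lookup TutteEdges i)) ≡ lookup C (proj₂ (lookup TutteEdges i))

-- Testing `v ∈ C` and `Saturated σ C` on the computed set replaces a proof that `explore` is
-- complete.
OddComponent : Subset 46 → PartialSubset 69 → Fin 46 → Subset 46 → Set
OddComponent N σ v C = ¬ 2 ∣ ∣ C ∩ ∁ N ∣ × v ∈ C × Saturated σ C

oddComponent? : ∀ N σ v C → Dec (OddComponent N σ v C)
oddComponent? N σ v C = ¬? (2 ∣? ∣ C ∩ ∁ N ∣) ×-dec v ∈? C ×-dec all? λ i →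
  Maybe-≡-dec Bool._≟_ (lookup σ i) (just false) ⊎-dec
  (lookup C (proj₁ (lookup TutteEdges i)) Bool.≟ lookup C (proj₂ (lookup TutteEdges i)))

-- d is the number of edges still to be chosen; a branch that cannot choose exactly d of them
-- succeeds vacuously.
branch  : PartialSubset 69 → List Arc → ℕ → (PartialSubset 69 → Bool) → Bool
include : PartialSubset 69 → Fin 69 → List Arc → ℕ → (PartialSubset 69 → Bool) → Bool

branch σ []             zero    k = k σ
branch σ []             (suc _) k = true
branch σ ((i , _) ∷ as) d       k with lookup σ i
... | just true  = include σ i as d k
... | just false = branch σ as d k
... | nothing    = include σ i as d k ∧ branch (σ [ i ]≔ just false) as d k

include σ i as zero    k = true
include σ i as (suc d) k = branch (σ [ i ]≔ just true) as d k

search : ArcTable → Subset 46 → List (Fin 46) → PartialSubset 69 → Bool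
-- A branch that outlives the list counts as failure, so success means that every branch was closed.
search arcs N []       σ = false
search arcs N (v ∷ vs) σ = branch σ (lookup arcs v) 2 λ τ →
  ⌊ oddComponent? N τ v (component arcs τ v) ⌋ ∨ search arcs N vs τ

-- `Reach` grows at its start, whereas `explore` extends paths at their far end.
snoc : ∀ {F u v w} → Reach F u v → AdjIn F v w → Reach F u w
snoc here       b = step b here
snoc (step a r) b = step a (snoc r b)

module _ {F : Subset 69} {σ : PartialSubset 69} (σ⊑F : σ ⊑ F) where

  module _ {arcs : ArcTable} (arcs-ends : HasEnds arcs) (v : Fin 46) where

    Reached : Subset 46 → Set
    Reached C = ∀ {w} → w ∈ C → Reach F v w

    insert-reached : ∀ {u C} → Reach F v u → Reached C → Reached (C [ u ]≔ inside)
    insert-reached {u} {C} v↝u r {w} w∈ with w ≟ u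
    ... | yes refl = v↝u
    ... | no  w≢u  =
      r (lookup⇒[]= w C (trans (sym (lookup∘update′ w≢u C inside)) ([]=⇒lookup w∈)))

    mutual
      -- Only edges decided `just true` are crossed, and `σ ⊑ F` puts these into `F`. Any fuel will
      -- do: when it runs out, the set found so far is returned.
      explore-reached : ∀ k {u C} → Reach F v u → Reached C →
        Reached (explore arcs σ k u C)
      explore-reached zero            v↝u r = r
      explore-reached (suc k) {u} {C} v↝u r with lookup C u
      ... | true  = r
      ... | false =
        exploreAll-reached k v↝u (arcs-ends u) (insert-reached v↝u r)

      exploreAll-reached : ∀ k {u as C} → Reach F v u → All (λ (i , w) → Ends i u w) as →
        Reached C → Reached (exploreAll arcs σ k as C)
      exploreAll-reached k v↝u []                         r = r
      exploreAll-reached k {as = (i , w) ∷ _} v↝u (e ∷ es) r with lookup σ i in σi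
      ... | just true  = exploreAll-reached k v↝u es
        (explore-reached k (snoc v↝u (i , lookup⇒[]= i F (agrees σ⊑F i σi) , e)) r)
      ... | just false = exploreAll-reached k v↝u es r
      ... | nothing    = exploreAll-reached k v↝u es r

    component-reached : Reached (component arcs σ v)
    component-reached = explore-reached 47 here (⊥-elim ∘ ∉⊥)

  adjacent-closed : ∀ {C u w} → Saturated σ C → AdjIn F u w → lookup C u ≡ lookup C w
  adjacent-closed saturated (i , i∈F , e) with saturated i
  ... | inj₁ σi with () ← trans (sym ([]=⇒lookup i∈F)) (agrees σ⊑F i σi)
  adjacent-closed {C} _ (_ , _ , inj₁ e) | inj₂ eq =
    trans (cong (lookup C ∘ proj₁) (sym e)) (trans eq (cong (lookup C ∘ proj₂) e))
  adjacent-closed {C} _ (_ , _ , inj₂ e) | inj₂ eq =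
    trans (cong (lookup C ∘ proj₂) (sym e)) (trans (sym eq) (cong (lookup C ∘ proj₁) e))

  reach-closed : ∀ {C u w} → Saturated σ C → Reach F u w → u ∈ C → w ∈ C
  reach-closed         saturated here       u∈C = u∈C
  reach-closed {C = C} saturated (step a r) u∈C = reach-closed {C = C} saturated r
    (lookup⇒[]= _ C (trans (sym (adjacent-closed {C = C} saturated a)) ([]=⇒lookup u∈C)))

  -- One inclusion holds because the search stays on edges of `F`, the other because a saturated set
  -- containing `v` cannot be left along `F`.
  component-isComponent : ∀ arcs {v} → HasEnds arcs → let C = component arcs σ v in
    v ∈ C → Saturated σ C → IsComponentOf F v C
  component-isComponent arcs {v} arcs-ends v∈C saturated w =
    component-reached {arcs = arcs} arcs-ends v ,
    λ r → reach-closed {C = component arcs σ v} saturated r v∈C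

-- `F` itself selects a path through the tree: at each undecided edge, follow the conjunct that
-- matches its choice. Agreement with `F` is preserved, and the path ends in a call of `k`.
branch-sound : ∀ {F k} σ as {d} → σ ⊑ F → countIn F (List.map proj₁ as) ≡ d →
  branch σ as d k ≡ true → ∃ λ τ → τ ⊑ F × k τ ≡ true
include-sound : ∀ {F k} σ i as {d} → σ ⊑ F → lookup F i ≡ true →
  countIn F (i ∷ List.map proj₁ as) ≡ d →
  include σ i as d k ≡ true → ∃ λ τ → τ ⊑ F × k τ ≡ true

branch-sound σ [] σ⊑F refl ok = σ , σ⊑F , ok
branch-sound {F} {k} σ ((i , _) ∷ as) {d} σ⊑F count ok with lookup σ i in σi
... | just true  = include-sound σ i as σ⊑F (agrees σ⊑F i σi) count ok
... | just false = branch-sound σ as σ⊑F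
  (subst (λ b → toℕ b + countIn F (List.map proj₁ as) ≡ d) (agrees σ⊑F i σi) count) ok
... | nothing with lookup F i in Fi
...   | true  = include-sound σ i as σ⊑F Fi
  (subst (λ b → toℕ b + countIn F (List.map proj₁ as) ≡ d) (sym Fi) count)
  (∧-conicalˡ _ _ ok)
...   | false = branch-sound (σ [ i ]≔ just false) as (update-⊑ i σ⊑F Fi) count
  (∧-conicalʳ (include σ i as d k) _ ok)

-- The other vacuous success: `F` contains `i`, so its count cannot be 0.
include-sound σ i as {zero} σ⊑F Fi count ok rewrite Fi with () ← count
include-sound {F} σ i as {suc d} σ⊑F Fi count ok = branch-sound (σ [ i ]≔ just true) as
  (update-⊑ i σ⊑F Fi)
  (suc-injective (subst (λ b → toℕ b + countIn F (List.map proj₁ as) ≡ suc d) Fi count)) ok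

twoFactor-countIn : ∀ {F arcs} → HasEdges arcs → IsTwoFactor F →
  ∀ v → countIn F (List.map proj₁ (lookup arcs v)) ≡ 2
twoFactor-countIn {F} arcs-edges twoFactor v = trans (cong (countIn F) (arcs-edges v))
  (trans (sym (∣∩∣≡countIn F (incident v))) (twoFactor v))

⌊⌋∨-split : ∀ {A : Set} (a? : Dec A) {b} → ⌊ a? ⌋ ∨ b ≡ true → A ⊎ b ≡ true
⌊⌋∨-split (yes a) _  = inj₁ a
⌊⌋∨-split (no  _) eq = inj₂ eq

module _ (arcs : ArcTable) (arcs-edges : HasEdges arcs) (arcs-ends : HasEnds arcs)
         (N : Subset 46) {F : Subset 69} (twoFactor : IsTwoFactor F) where

  -- Valid for any list `vs`: the path that `F` follows cannot reach the end of the list, where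
  -- `search` is `false`, so it meets an odd component on the way.
  search-sound : ∀ vs σ → σ ⊑ F → search arcs N vs σ ≡ true →
    ∃ λ v → ∃ λ C → IsComponentOf F v C × ¬ 2 ∣ ∣ C ∩ ∁ N ∣
  search-sound (v ∷ vs) σ σ⊑F ok =
    let τ , τ⊑F , ok′ = branch-sound σ (lookup arcs v) σ⊑F
          (twoFactor-countIn {arcs = arcs} arcs-edges twoFactor v) ok
        C = component arcs τ v
    in [ (λ (odd , v∈C , saturated) →
           v , C , component-isComponent τ⊑F arcs arcs-ends v∈C saturated , odd)
       , search-sound vs τ τ⊑F
       ]′ (⌊⌋∨-split (oddComponent? N τ v C) ok′)

Negative : Subset 46
Negative = List.foldr (λ v S → S [ v ]≔ inside) ∅
  (# 1 ∷ # 2 ∷ # 5 ∷ # 9 ∷ # 12 ∷ # 14 ∷ # 19 ∷ # 22 ∷ # 23 ∷ # 24 ∷ # 41 ∷ # 44 ∷ [])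

-- Vertex 35 is absent: its three edges are decided at its neighbours 12, 34 and 36, and all
-- branches close without imposing its degree.
order : List (Fin 46)
order =
  # 16 ∷ # 44 ∷ # 43 ∷ # 17 ∷ # 18 ∷ # 3 ∷ # 45 ∷ # 42 ∷ # 19 ∷ # 41 ∷ # 40 ∷ # 20 ∷
  # 21 ∷ # 22 ∷ # 15 ∷ # 13 ∷ # 23 ∷ # 24 ∷ # 27 ∷ # 32 ∷ # 28 ∷ # 31 ∷ # 25 ∷ # 29 ∷
  # 30 ∷ # 33 ∷ # 26 ∷ # 1 ∷ # 4 ∷ # 5 ∷ # 6 ∷ # 0 ∷ # 2 ∷ # 12 ∷ # 11 ∷ # 39 ∷ # 10 ∷
  # 14 ∷ # 7 ∷ # 8 ∷ # 9 ∷ # 37 ∷ # 38 ∷ # 34 ∷ # 36 ∷ []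

-- Proved by evaluating the search. A Hamiltonian cycle would contain all 34 positive vertices, an
-- even number, and its branch would survive; so this also re-establishes that the Tutte graph is
-- not Hamiltonian.
search-succeeds : search tutteArcs Negative order (replicate 69 nothing) ≡ true
search-succeeds = refl

theorem3 : Σ (Subset 46) λ N → ∣ N ∣ ≡ 12 ×
    ¬ (Σ (Subset 69) λ F → IsTwoFactor F ×
    ((v : Fin 46) (C : Subset 46) → IsComponentOf F v C → 2 ∣ ∣ C ∩ ∁ N ∣))
theorem3 = Negative , refl , λ (F , twoFactor , even) →
  let v , C , isComponent , odd =
        search-sound tutteArcs tutteArcs-edges tutteArcs-ends Negative twoFactor
          order _ (undecided-⊑ F) search-succeeds
  in odd (even v C isComponent)
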